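{- There is a constant $c>0$ such that for infinitely many positive integers $g$, there exists a graph of girth at least $7$ embeddable on a surface of Euler genus $g$ that has no $(0,\lfloor c\sqrt{g}\rfloor)$-coloring.
   Context: All graphs are finite and simple (no loops, no multiple edges). For integers $d_1,\ldots,d_k$, a $(d_1,\ldots,d_k)$-coloring of a graph $G$ is an assignment to each vertex of a color from $\{1,\ldots,k\}$ such that for each $i$, every vertex colored $i$ has at most $d_i$ neighbors colored $i$. Girth at least $7$ means that the graph has no cycle of length less than $7$. A surface is a non-null compact connected 2-manifold without boundary. The Euler genus of a surface is $2h$ if it is the orientable surface obtained from the sphere by adding $h\ge 0$ handles, and $k$ if it is the non-orientable surface obtained from the sphere by adding $k\ge 1$ cross-caps. -}

module Defs where

open import Data.Bool.Base using (Bool; not)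
open import Data.Fin.Base using (Fin)
import Data.Fin.Properties as Fin
open import Data.Integer.Base as ℤ using (ℤ; +_)
open import Data.List.Base using (List; []; _∷_; _∷ʳ_; length; filter; allFin)
open import Data.List.Relation.Unary.Linked using (Linked)
open import Data.List.Relation.Unary.Unique.Propositional using (Unique)
open import Data.Nat.Base using (ℕ; suc; _+_; _*_; _≤_; NonZero)
open import Data.Product.Base using (Σ-syntax; ∃-syntax; _×_)
open import Data.Rational.Unnormalised.Base as ℚᵘ using (ℚᵘ)
open import Data.Sum.Base using (_⊎_)
open import Data.Vec.Base using (Vec; lookup)
open import Function.Bundles using (_⇔_)
open import Function.Definitions using (Injective; Surjective)
open import Level using (0ℓ)
open import Relation.Binary.Construct.Closure.Equivalence using (EqClosure)
open import Relation.Binary.Core using (Rel)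
open import Relation.Binary.Definitions using (Decidable; Irreflexive; Symmetric)
open import Relation.Binary.PropositionalEquality.Core using (_≡_; _≢_)
open import Relation.Nullary.Decidable.Core using (_×-dec_)
open import Relation.Nullary.Negation.Core using (¬_)

record Graph : Set₁ where
  field
    order  : ℕ
    Adj    : Rel (Fin order) 0ℓ
    adj?   : Decidable Adj
    sym    : Symmetric Adj
    irrefl : Irreflexive _≡_ Adj

  Vertex : Set
  Vertex = Fin order

module _ (G : Graph) where
  open Graph G

  record Cycle : Set where
    field
      start    : Vertex
      rest     : List Vertex
      closed   : Linked Adj (start ∷ rest ∷ʳ start)
      distinct : Unique (start ∷ rest)
      long     : 3 ≤ length (start ∷ rest)

    cycleLength : ℕ
    cycleLength = length (start ∷ rest)

  GirthAtLeast : ℕ → Set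
  GirthAtLeast m = (C : Cycle) → m ≤ Cycle.cycleLength C

  sameColorNeighbors : ∀ {k} → (Vertex → Fin k) → Vertex → List Vertex
  sameColorNeighbors color v =
    filter (λ w → adj? v w ×-dec (color w Fin.≟ color v)) (allFin order)

  -- d lists d₁, …, d_k.
  Colorable : ∀ {k} → Vec ℕ k → Set
  Colorable {k} d =
    Σ[ color ∈ (Vertex → Fin k) ]
      (∀ v → length (sameColorNeighbors color v) ≤ lookup d (color v))

-- The closed surfaces, as listed by the classification theorem.
data Surface : Set where
  sphereWithHandles   : (h : ℕ) → Surface
  sphereWithCrossCaps : (k : ℕ) .{{_ : NonZero k}} → Surface

eulerGenus : Surface → ℕ
eulerGenus (sphereWithHandles h)   = 2 * h
eulerGenus (sphereWithCrossCaps k) = k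

module _ {n : ℕ} where

  SameOrbit₂ : (f g : Fin n → Fin n) → Rel (Fin n) 0ℓ
  SameOrbit₂ f g = EqClosure (λ x y → f x ≡ y ⊎ g x ≡ y)

  SameOrbit₃ : (f g h : Fin n → Fin n) → Rel (Fin n) 0ℓ
  SameOrbit₃ f g h = EqClosure (λ x y → f x ≡ y ⊎ g x ≡ y ⊎ h x ≡ y)

  -- An enumeration of the orbits of the group generated by the involutions
  -- f and g.
  record Cells (f g : Fin n → Fin n) : Set where
    field
      count  : ℕ
      cellOf : Fin n → Fin count
      onto   : Surjective _≡_ _≡_ cellOf
      orbits : ∀ x y → cellOf x ≡ cellOf y ⇔ SameOrbit₂ f g x y

-- A cell decomposition of a closed connected surface (a connected generalized
-- map, in which loops and multiple edges are allowed).  The flags are the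
-- triangles of the barycentric subdivision: a flag has one corner on a vertex,
-- one on an edge and one on a face, and τᵢ x is the triangle glued to x along
-- the side opposite the corner of dimension i.  So τ₀, τ₁, τ₂ change only the
-- vertex, only the edge, only the face of a flag, and a vertex, edge or face is
-- an orbit of the two involutions that keep it.  The laws on τ₀ and τ₂ say that
-- four distinct flags surround each edge.
record CellDecomposition : Set where
  field
    flags     : ℕ
    nonNull   : NonZero flags
    τ₀ τ₁ τ₂  : Fin flags → Fin flags
    τ₀-invol  : ∀ x → τ₀ (τ₀ x) ≡ x
    τ₁-invol  : ∀ x → τ₁ (τ₁ x) ≡ x
    τ₂-invol  : ∀ x → τ₂ (τ₂ x) ≡ x
    τ₀-free   : ∀ x → τ₀ x ≢ x
    τ₁-free   : ∀ x → τ₁ x ≢ x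
    τ₂-free   : ∀ x → τ₂ x ≢ x
    τ₀τ₂-comm : ∀ x → τ₀ (τ₂ x) ≡ τ₂ (τ₀ x)
    τ₀τ₂-free : ∀ x → τ₀ (τ₂ x) ≢ x
    connected : ∀ x y → SameOrbit₃ τ₀ τ₁ τ₂ x y
    vertices  : Cells τ₁ τ₂
    edges     : Cells τ₀ τ₂
    faces     : Cells τ₀ τ₁

  Flag : Set
  Flag = Fin flags

  MapVertex : Set
  MapVertex = Fin (Cells.count vertices)

  vertexOf : Flag → MapVertex
  vertexOf = Cells.cellOf vertices

  eulerCharacteristic : ℤ
  eulerCharacteristic =
    + Cells.count vertices ℤ.- + Cells.count edges ℤ.+ + Cells.count faces

  -- The triangles can be oriented so that glued ones are oriented coherently.
  Orientable : Set
  Orientable =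
    Σ[ side ∈ (Flag → Bool) ]
      (∀ x → side (τ₀ x) ≡ not (side x)
           × side (τ₁ x) ≡ not (side x)
           × side (τ₂ x) ≡ not (side x))

-- M decomposes S.  By the classification theorem, a closed surface is
-- determined up to homeomorphism by its orientability and its Euler
-- characteristic, which are 2 - 2h for h handles and 2 - k for k cross-caps.
_Decomposes_ : CellDecomposition → Surface → Set
M Decomposes S@(sphereWithHandles _) =
  CellDecomposition.Orientable M
  × CellDecomposition.eulerCharacteristic M ≡ + 2 ℤ.- + eulerGenus S
M Decomposes S@(sphereWithCrossCaps _) =
  ¬ CellDecomposition.Orientable M
  × CellDecomposition.eulerCharacteristic M ≡ + 2 ℤ.- + eulerGenus S

-- G is a subgraph of the 1-skeleton of M.  As G is simple, distinct edges of G
-- have distinct pairs of ends, hence are drawn along distinct edges of M.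
_DrawnIn_ : Graph → CellDecomposition → Set
G DrawnIn M =
  Σ[ φ ∈ (Vertex → MapVertex) ]
    Injective _≡_ _≡_ φ
    × (∀ u v → Adj u v →
         ∃[ x ] (vertexOf x ≡ φ u × vertexOf (τ₀ x) ≡ φ v))
  where
  open Graph G
  open CellDecomposition M

-- A graph drawn on S without crossings extends, by adding vertices and edges,
-- to the 1-skeleton of a cell decomposition of S.  The faces of the drawing of
-- G itself need not be discs, and G need not be connected.
_EmbeddableOn_ : Graph → Surface → Set
G EmbeddableOn S =
  Σ[ M ∈ CellDecomposition ] (M Decomposes S × G DrawnIn M)

fromℕ : ℕ → ℚᵘ
fromℕ m = + m ℚᵘ./ 1

-- k = ⌊c √g⌋ for c ≥ 0, that is k ≤ c √g < k + 1, with the inequalities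
-- squared.
_IsFloorOf_√_ : ℕ → ℚᵘ → ℕ → Set
k IsFloorOf c √ g =
  fromℕ k ℚᵘ.* fromℕ k ℚᵘ.≤ c ℚᵘ.* c ℚᵘ.* fromℕ g
  × c ℚᵘ.* c ℚᵘ.* fromℕ g ℚᵘ.< fromℕ (suc k) ℚᵘ.* fromℕ (suc k)

{-# OPTIONS --safe #-}

-- The graph has two sides of m twin pairs of hubs; twins are adjacent, and any
-- two hubs on different sides are joined by a path of length 3.  In a
-- (0, k)-coloring some hub of every twin pair has the second color, and so has
-- an inner vertex of each of the m² paths between these 2m hubs, although each
-- of the hubs has at most k such neighbors: hence m² ≤ 2mk.  Every cycle
-- changes sides, so it runs through two or more of the paths, and it needs a
-- seventh edge since two paths with the same ends are equal.
--
-- For the embedding take a sphere for every vertex and join the spheres of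
-- adjacent vertices by a tube.  If each edge is drawn twice along its tube, with
-- the two copies in the same (not the opposite) rotational order at both ends,
-- then there is just one face for every sphere, so that
-- χ = 2 (#vertices − #edges) and the Euler genus g is less than 8m².  Thus
-- k ≤ √g / 8 gives m > 2k, and there is no (0, k)-coloring.

module Submission where

open import Defs
open import Data.Bool.Base using (Bool; true; false; not)
open import Data.Bool.Properties as Bool using (not-involutive; not-¬)
open import Data.Fin.Base as Fin using (Fin; zero; suc; inject₁)
open import Data.Fin.Induction using (<-weakInduction)
open import Data.Fin.Properties as Fin using (*↔×; +↔⊎; 1↔⊤; 2↔Bool)
open import Data.Fin.Relation.Unary.Top using (view; view-fromℕ; view-inject₁; ‵fromℕ; ‵inject₁)
open import Data.Integer.Base as ℤ using (+_)
import Data.Integer.Properties as ℤ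
open import Data.Integer.Tactic.RingSolver using () renaming (solve-∀ to solve-∀ℤ)
open import Data.List.Base using (List; []; _∷_; _∷ʳ_; length)
open import Data.List.Membership.Propositional using (_∈_)
open import Data.List.Membership.Propositional.Properties using (∈-filter⁺; ∈-allFin)
open import Data.List.Membership.Setoid.Properties using (index-injective)
open import Data.List.Relation.Unary.All as All using (All; []; _∷_)
open import Data.List.Relation.Unary.AllPairs using ([]; _∷_)
open import Data.List.Relation.Unary.Any using (index)
open import Data.List.Relation.Unary.Linked as Linked using (Linked; [-]; _∷_)
open import Data.List.Relation.Unary.Unique.Propositional using (Unique)
open import Data.Nat.Base using (ℕ; zero; suc; _+_; _*_; _≤_; _<_; z≤n; s≤s; NonZero)
import Data.Nat.Properties as ℕ
open import Data.Nat.Tactic.RingSolver using (solve-∀)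
open import Data.Product.Base using (Σ-syntax; ∃-syntax; _×_; _,_; proj₁; proj₂)
open import Data.Product.Function.NonDependent.Propositional using (_×-↔_)
open import Data.Product.Properties using (≡-dec; ,-injectiveˡ; ,-injectiveʳ)
open import Data.Rational.Unnormalised.Base as ℚᵘ using (ℚᵘ; 0ℚᵘ; mkℚᵘ; *≤*; *<*)
open import Data.Sum.Base using (_⊎_; inj₁; inj₂)
open import Data.Sum.Function.Propositional using (_⊎-↔_)
open import Data.Sum.Properties using (inj₁-injective; inj₂-injective)
open import Data.Unit.Base using (⊤; tt)
open import Data.Vec.Base using (Vec; []; _∷_; lookup)
open import Function.Base using (_∘_)
open import Function.Bundles using (_↔_; mk⇔; Inverse)
open import Function.Definitions using (Injective)
open import Function.Properties.Inverse using (↔-refl; ↔-sym; ↔-trans)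
open import Level using (0ℓ)
open import Relation.Binary.Construct.Closure.Equivalence as EqC using (EqClosure)
open import Relation.Binary.Construct.Closure.ReflexiveTransitive using (ε; _◅◅_)
open import Relation.Binary.Core using (Rel)
open import Relation.Binary.Definitions using (Decidable; DecidableEquality; Symmetric)
open import Relation.Binary.PropositionalEquality
open import Relation.Nullary.Decidable using (yes; no; _×-dec_)
open import Relation.Nullary.Negation using (¬_; contradiction)

private
  variable
    A B C : Set
    a b c n : ℕ

Step : (A → A) → Rel A 0ℓ
Step f x y = f x ≡ y

-- These mirror `SameOrbit₂` and `SameOrbit₃` on arbitrary types, so that flags can be structured
-- tuples until the map is assembled.
Orbit₂ : (f g : A → A) → Rel A 0ℓ
Orbit₂ f g = EqClosure (λ x y → f x ≡ y ⊎ g x ≡ y)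

Orbit₃ : (f g h : A → A) → Rel A 0ℓ
Orbit₃ f g h = EqClosure (λ x y → f x ≡ y ⊎ g x ≡ y ⊎ h x ≡ y)

-- Cyclic permutations of finite types

-- `transitive` says that `next` has a single cycle. This is what makes all the flags around a
-- vertex of the map one orbit, and those of a face as well.
record CyclicOrder (A : Set) : Set where
  field
    next prev  : A → A
    next-prev  : ∀ x → next (prev x) ≡ x
    prev-next  : ∀ x → prev (next x) ≡ x
    transitive : ∀ x y → EqClosure (Step next) x y

Fin-cyclicOrder : ∀ n → CyclicOrder (Fin (suc n))
Fin-cyclicOrder n = record
  { next       = next
  ; prev       = prev
  ; next-prev  = next-prev
  ; prev-next  = prev-next
  ; transitive = λ x y → EqC.symmetric _ (from-zero x) ◅◅ from-zero y
  }
  where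
  next : Fin (suc n) → Fin (suc n)
  next i with view i
  ... | ‵fromℕ     = zero
  ... | ‵inject₁ j = suc j

  prev : Fin (suc n) → Fin (suc n)
  prev zero    = Fin.fromℕ n
  prev (suc i) = inject₁ i

  next-inject₁ : ∀ i → next (inject₁ i) ≡ suc i
  next-inject₁ i rewrite view-inject₁ i = refl

  next-prev : ∀ i → next (prev i) ≡ i
  next-prev zero rewrite view-fromℕ n = refl
  next-prev (suc i) = next-inject₁ i

  prev-next : ∀ i → prev (next i) ≡ i
  prev-next i with view i
  ... | ‵fromℕ     = refl
  ... | ‵inject₁ j = refl

  from-zero : ∀ i → EqClosure (Step next) zero i
  from-zero = <-weakInduction _ ε (λ i p → p ◅◅ EqC.return (next-inject₁ i))

cyclicOrder : A ↔ Fin (suc n) → CyclicOrder A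
cyclicOrder {n = n} e = record
  { next       = from ∘ next ∘ to
  ; prev       = from ∘ prev ∘ to
  ; next-prev  = λ x → trans (cong (from ∘ next) (strictlyInverseˡ _))
                         (trans (cong from (next-prev _)) (strictlyInverseʳ x))
  ; prev-next  = λ x → trans (cong (from ∘ prev) (strictlyInverseˡ _))
                         (trans (cong from (prev-next _)) (strictlyInverseʳ x))
  ; transitive = λ x y → subst₂ (EqClosure _) (strictlyInverseʳ x) (strictlyInverseʳ y)
      (EqC.gmap from (λ { refl → cong (from ∘ next) (strictlyInverseˡ _) })
        (transitive (to x) (to y)))
  }
  where
  open Inverse e
  open CyclicOrder (Fin-cyclicOrder n)

-- Transport of cells along an enumeration of the flags

conjugate : A ↔ Fin n → (A → A) → Fin n → Fin n
conjugate e f = Inverse.to e ∘ f ∘ Inverse.from e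

module _ (e : A ↔ Fin n) where
  open Inverse e

  conjugate-to : ∀ f x → conjugate e f (to x) ≡ to (f x)
  conjugate-to f x = cong (to ∘ f) (strictlyInverseʳ x)

  conjugate-commute : ∀ (f g h : A → A) → (∀ x → f (g x) ≡ h x) →
    ∀ i → conjugate e f (conjugate e g i) ≡ conjugate e h i
  conjugate-commute f g h fg≡h i = trans (conjugate-to f _) (cong to (fg≡h _))

  conjugate-invol : ∀ (f : A → A) → (∀ x → f (f x) ≡ x) →
    ∀ i → conjugate e f (conjugate e f i) ≡ i
  conjugate-invol f f-invol i =
    trans (conjugate-commute f f (λ x → x) f-invol i) (strictlyInverseˡ i)

  conjugate-free : ∀ (f : A → A) → (∀ x → f x ≢ x) → ∀ i → conjugate e f i ≢ i
  conjugate-free f f-free i fi≡i =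
    f-free (from i) (trans (sym (strictlyInverseʳ _)) (cong from fi≡i))

  conjugate-orbit₂ : ∀ {f g : A → A} {x y} → Orbit₂ f g x y →
    SameOrbit₂ (conjugate e f) (conjugate e g) (to x) (to y)
  conjugate-orbit₂ {f} {g} = EqC.gmap to
    (λ { {x} (inj₁ refl) → inj₁ (conjugate-to f x)
       ; {x} (inj₂ refl) → inj₂ (conjugate-to g x) })

  conjugate-orbit₃ : ∀ {f g h : A → A} {x y} → Orbit₃ f g h x y →
    SameOrbit₃ (conjugate e f) (conjugate e g) (conjugate e h) (to x) (to y)
  conjugate-orbit₃ {f} {g} {h} = EqC.gmap to
    (λ { {x} (inj₁ refl)        → inj₁ (conjugate-to f x)
       ; {x} (inj₂ (inj₁ refl)) → inj₂ (inj₁ (conjugate-to g x))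
       ; {x} (inj₂ (inj₂ refl)) → inj₂ (inj₂ (conjugate-to h x)) })

  -- Two flags with the same cell are joined through the common representative `rep`; conversely
  -- `cell` is constant along `f` and `g`, hence on orbits.
  transportCells : ∀ (f g : A → A) → C ↔ Fin c → (cell : A → C) (rep : C → A) →
    (∀ z → cell (rep z) ≡ z) →
    (∀ x → cell (f x) ≡ cell x) → (∀ x → cell (g x) ≡ cell x) →
    (∀ x → Orbit₂ f g (rep (cell x)) x) →
    Cells (conjugate e f) (conjugate e g)
  transportCells {c = c} f g eC cell rep cell-rep cell-f cell-g rep-orbit = record
    { count  = c
    ; cellOf = cellOf
    ; onto   = λ z → to (rep (C.from z)) , λ { refl → trans (cong C.to (trans
        (cong cell (strictlyInverseʳ _)) (cell-rep _))) (C.strictlyInverseˡ z) }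
    ; orbits = λ x y → mk⇔ (same x y)
        (EqC.gfold isEquivalence cellOf (λ { {x} (inj₁ refl) → invariant f cell-f x
                                           ; {x} (inj₂ refl) → invariant g cell-g x }))
    }
    where
    module C = Inverse eC
    cellOf : Fin _ → Fin c
    cellOf = C.to ∘ cell ∘ from

    invariant : ∀ h → (∀ x → cell (h x) ≡ cell x) → ∀ i → cellOf i ≡ cellOf (conjugate e h i)
    invariant h cell-h i =
      cong C.to (sym (trans (cong cell (strictlyInverseʳ _)) (cell-h _)))

    same : ∀ i j → cellOf i ≡ cellOf j → SameOrbit₂ (conjugate e f) (conjugate e g) i j
    same i j eq = subst₂ (SameOrbit₂ _ _) (strictlyInverseˡ i) (strictlyInverseˡ j)
      (conjugate-orbit₂ (EqC.symmetric _ (rep-orbit (from i)) ◅◅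
        subst (λ z → Orbit₂ f g (rep z) (from j)) (sym cells≡) (rep-orbit (from j))))
      where
      cells≡ : cell (from i) ≡ cell (from j)
      cells≡ = trans (sym (C.strictlyInverseʳ _)) (trans (cong C.from eq) (C.strictlyInverseʳ _))

-- Spheres joined by tubes

-- A graph given by its darts, with a cyclic order of the darts around each vertex. `positive` marks
-- one of the two darts of each edge, and `dartAt` excludes isolated vertices.
record RotationSystem (V D : Set) : Set where
  field
    source        : D → V
    reverse       : D → D
    positive      : D → Bool
    next prev     : D → D
    dartAt        : V → D
    reverse-invol : ∀ d → reverse (reverse d) ≡ d
    positive-rev  : ∀ d → positive (reverse d) ≡ not (positive d)
    next-prev     : ∀ d → next (prev d) ≡ d
    prev-next     : ∀ d → prev (next d) ≡ d
    source-next   : ∀ d → source (next d) ≡ source d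
    source-dartAt : ∀ v → source (dartAt v) ≡ v
    next-orbit    : ∀ d → EqClosure (Step next) (dartAt (source d)) d

  target : D → V
  target d = source (reverse d)

  Link : Rel V 0ℓ
  Link u v = ∃[ d ] (source d ≡ u × target d ≡ v)

module TubeMap {V D : Set} (R : RotationSystem V D) where
  open RotationSystem R

  -- Around a vertex, the flags of a dart d come in the order (d , false , false),
  -- (d , false , true), (d , true , false), (d , true , true): the first bit
  -- tells the two copies of the edge apart, the second one the sides of a copy.
  -- The two ends of an edge agree on which copy comes first.
  Flag : Set
  Flag = D × Bool × Bool

  τ₀ τ₁ τ₂ τ₀τ₂ : Flag → Flag
  -- Parallel copies would have `not h` here, and a digon would arise between them.
  τ₀ (d , h , b) = reverse d , h , not b
  τ₁ (d , false , false) = prev d , true , true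
  τ₁ (d , false , true)  = d , true , false
  τ₁ (d , true , false)  = d , false , true
  τ₁ (d , true , true)   = next d , false , false
  τ₂ (d , h , b) = d , h , not b
  τ₀τ₂ (d , h , b) = reverse d , h , b

  τ₀-invol : ∀ x → τ₀ (τ₀ x) ≡ x
  τ₀-invol (d , h , b) = cong₂ (λ d b → d , h , b) (reverse-invol d) (not-involutive b)

  τ₁-invol : ∀ x → τ₁ (τ₁ x) ≡ x
  τ₁-invol (d , false , false) = cong (_, _) (next-prev d)
  τ₁-invol (d , false , true)  = refl
  τ₁-invol (d , true , false)  = refl
  τ₁-invol (d , true , true)   = cong (_, _) (prev-next d)

  τ₂-invol : ∀ x → τ₂ (τ₂ x) ≡ x
  τ₂-invol (d , h , b) = cong (λ b → d , h , b) (not-involutive b)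

  -- All three involutions flip this bit. Therefore none of them has a fixed point, and the bit
  -- orients the map.
  side : Flag → Bool
  side (d , h , b) = b

  side-τ₁ : ∀ x → side (τ₁ x) ≡ not (side x)
  side-τ₁ (d , false , false) = refl
  side-τ₁ (d , false , true)  = refl
  side-τ₁ (d , true , false)  = refl
  side-τ₁ (d , true , true)   = refl

  free : ∀ (τ : Flag → Flag) → (∀ x → side (τ x) ≡ not (side x)) → ∀ x → τ x ≢ x
  free τ side-τ x τx≡x = not-¬ refl (trans (sym (cong side τx≡x)) (side-τ x))

  reverse-free : ∀ d → reverse d ≢ d
  reverse-free d eq = not-¬ refl (trans (sym (cong positive eq)) (positive-rev d))

  τ₀τ₂-free : ∀ x → τ₀τ₂ x ≢ x
  τ₀τ₂-free (d , h , b) eq = reverse-free d (cong (λ { (d , _) → d }) eq)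

  base : D → Flag
  base d = d , false , false

  -- Serves for vertices and for faces: in both it is enough to get from each dart to the next one
  -- around its source.
  base-orbit : ∀ {ρ : Rel Flag 0ℓ} →
    (∀ d → EqClosure ρ (base d) (base (next d))) →
    ∀ d → EqClosure ρ (base (dartAt (source d))) (base d)
  base-orbit {ρ} step d = EqC.gfold (EqC.isEquivalence ρ) base (λ { {x} refl → step x }) (next-orbit d)

  origin : Flag → V
  origin (d , _) = source d

  vertex-τ₁ : ∀ x → origin (τ₁ x) ≡ origin x
  vertex-τ₁ (d , false , false) =
    trans (sym (source-next _)) (cong source (next-prev d))
  vertex-τ₁ (d , false , true)  = refl
  vertex-τ₁ (d , true , false)  = refl
  vertex-τ₁ (d , true , true)   = source-next d

  vertex-base : ∀ (x@(d , _) : Flag) → Orbit₂ τ₁ τ₂ (base d) x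
  vertex-base (d , false , false) = ε
  vertex-base (d , false , true)  = EqC.return (inj₂ refl)
  vertex-base (d , true , false)  = EqC.return (inj₂ refl) ◅◅ EqC.return (inj₁ refl)
  vertex-base (d , true , true)   =
    EqC.return (inj₂ refl) ◅◅ EqC.return (inj₁ refl) ◅◅ EqC.return (inj₂ refl)

  vertex-rep : ∀ (x@(d , _) : Flag) → Orbit₂ τ₁ τ₂ (base (dartAt (source d))) x
  vertex-rep x@(d , _) =
    base-orbit (λ d → vertex-base (d , true , true) ◅◅ EqC.return (inj₁ refl)) d ◅◅ vertex-base x

  -- The face of a vertex `v` goes around `v`: out along the first copy of each dart, back along the
  -- second, on to the next dart. Its corners are those between consecutive darts at `v` and, at the
  -- far ends of these darts, those between the two copies.
  face : Flag → V
  face (d , false , false) = source d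
  face (d , false , true)  = target d
  face (d , true , false)  = target d
  face (d , true , true)   = source d

  face-τ₀ : ∀ x → face (τ₀ x) ≡ face x
  face-τ₀ (d , false , false) = cong source (reverse-invol d)
  face-τ₀ (d , false , true)  = refl
  face-τ₀ (d , true , false)  = refl
  face-τ₀ (d , true , true)   = cong source (reverse-invol d)

  face-τ₁ : ∀ x → face (τ₁ x) ≡ face x
  face-τ₁ (d , false , false) = trans (sym (source-next _)) (cong source (next-prev d))
  face-τ₁ (d , false , true)  = refl
  face-τ₁ (d , true , false)  = refl
  face-τ₁ (d , true , true)   = source-next d

  face-around : ∀ d → Orbit₂ τ₀ τ₁ (base d) (d , true , true)
  face-around d =
    EqC.return (inj₁ refl) ◅◅ EqC.return (inj₂ refl) ◅◅
    EqC.return (inj₁ (cong (_, _) (reverse-invol d)))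

  face-base : ∀ d → Orbit₂ τ₀ τ₁ (base (dartAt (source d))) (base d)
  face-base = base-orbit (λ d → face-around d ◅◅ EqC.return (inj₂ refl))

  face-rep : ∀ x → Orbit₂ τ₀ τ₁ (base (dartAt (face x))) x
  face-rep (d , false , false) = face-base d
  face-rep (d , false , true)  =
    face-base (reverse d) ◅◅ EqC.return (inj₁ (cong (_, _) (reverse-invol d)))
  face-rep (d , true , false)  =
    face-base (reverse d) ◅◅ EqC.return (inj₁ (cong (_, _) (reverse-invol d))) ◅◅
    EqC.return (inj₂ refl)
  face-rep (d , true , true)   = face-base d ◅◅ face-around d

  -- Of the two copies of the edge of a dart d, the copy h is named after the one
  -- of d and reverse d whose sign is h, so the darts enumerate the edges of the map.
  edge′ : Bool → Bool → D → D
  edge′ false false d = d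
  edge′ false true  d = reverse d
  edge′ true  false d = reverse d
  edge′ true  true  d = d

  edge : Flag → D
  edge (d , h , b) = edge′ (positive d) h d

  edgeFlag : D → Flag
  edgeFlag d = d , positive d , false

  edge-edgeFlag : ∀ d → edge (edgeFlag d) ≡ d
  edge-edgeFlag d with positive d
  ... | false = refl
  ... | true  = refl

  edge-τ₀ : ∀ x → edge (τ₀ x) ≡ edge x
  edge-τ₀ (d , h , b) rewrite positive-rev d with positive d | h
  ... | false | false = reverse-invol d
  ... | false | true  = refl
  ... | true  | false = refl
  ... | true  | true  = reverse-invol d

  edge-base : ∀ d h → Orbit₂ τ₀ τ₂ (edgeFlag (edge (d , h , false))) (d , h , false)
  edge-base d h with positive d in eq | h
  ... | false | false rewrite eq = ε
  ... | true  | true  rewrite eq = ε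
  ... | false | true  rewrite positive-rev d | eq =
    EqC.return (inj₁ (cong (_, _) (reverse-invol d))) ◅◅ EqC.return (inj₂ refl)
  ... | true  | false rewrite positive-rev d | eq =
    EqC.return (inj₁ (cong (_, _) (reverse-invol d))) ◅◅ EqC.return (inj₂ refl)

  edge-rep : ∀ x → Orbit₂ τ₀ τ₂ (edgeFlag (edge x)) x
  edge-rep (d , h , false) = edge-base d h
  edge-rep (d , h , true)  = edge-base d h ◅◅ EqC.return (inj₂ refl)

  module _ (connected : ∀ u v → EqClosure Link u v) where

    private
      _~_ : Rel Flag 0ℓ
      _~_ = Orbit₃ τ₀ τ₁ τ₂

    vertex⇒all : ∀ {x y} → Orbit₂ τ₁ τ₂ x y → x ~ y
    vertex⇒all = EqC.map inj₂

    link-orbit : ∀ {u v} → Link u v → base (dartAt u) ~ base (dartAt v)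
    link-orbit (d , refl , refl) =
      vertex⇒all (vertex-rep (base d)) ◅◅ EqC.return (inj₁ refl) ◅◅
      EqC.symmetric _ (vertex⇒all (vertex-rep (reverse d , false , true)))

    flags-connected : ∀ x y → x ~ y
    flags-connected x@(d , _) y@(d′ , _) =
      EqC.symmetric _ (vertex⇒all (vertex-rep x)) ◅◅
      EqC.gfold (EqC.isEquivalence _) (base ∘ dartAt) link-orbit
        (connected (source d) (source d′)) ◅◅
      vertex⇒all (vertex-rep y)

    module _ {v d f : ℕ} (V↔ : V ↔ Fin v) (D↔ : D ↔ Fin d) (Flag↔ : Flag ↔ Fin f)
             (root : D) where

      private module F = Inverse Flag↔

      tubeMap : CellDecomposition
      tubeMap = record
        { flags     = f
        ; nonNull   = inhabited⇒nonZero (F.to (base root))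
        ; τ₀        = conjugate Flag↔ τ₀
        ; τ₁        = conjugate Flag↔ τ₁
        ; τ₂        = conjugate Flag↔ τ₂
        ; τ₀-invol  = conjugate-invol Flag↔ τ₀ τ₀-invol
        ; τ₁-invol  = conjugate-invol Flag↔ τ₁ τ₁-invol
        ; τ₂-invol  = conjugate-invol Flag↔ τ₂ τ₂-invol
        ; τ₀-free   = conjugate-free Flag↔ τ₀ (free τ₀ λ _ → refl)
        ; τ₁-free   = conjugate-free Flag↔ τ₁ (free τ₁ side-τ₁)
        ; τ₂-free   = conjugate-free Flag↔ τ₂ (free τ₂ λ _ → refl)
        ; τ₀τ₂-comm = λ i → trans (conjugate-commute Flag↔ τ₀ τ₂ τ₀τ₂ τ₀τ₂≡ i)
                              (sym (conjugate-commute Flag↔ τ₂ τ₀ τ₀τ₂ τ₂τ₀≡ i))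
        ; τ₀τ₂-free = λ i eq → conjugate-free Flag↔ τ₀τ₂ τ₀τ₂-free i
                        (trans (sym (conjugate-commute Flag↔ τ₀ τ₂ τ₀τ₂ τ₀τ₂≡ i)) eq)
        ; connected = λ x y → subst₂ (SameOrbit₃ _ _ _) (F.strictlyInverseˡ x) (F.strictlyInverseˡ y)
                        (conjugate-orbit₃ Flag↔ (flags-connected (F.from x) (F.from y)))
        ; vertices  = transportCells Flag↔ τ₁ τ₂ V↔ origin (base ∘ dartAt) source-dartAt
                        vertex-τ₁ (λ _ → refl) vertex-rep
        ; edges     = transportCells Flag↔ τ₀ τ₂ D↔ edge edgeFlag edge-edgeFlag
                        edge-τ₀ (λ _ → refl) edge-rep
        ; faces     = transportCells Flag↔ τ₀ τ₁ V↔ face (base ∘ dartAt) source-dartAt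
                        face-τ₀ face-τ₁ face-rep
        }
        where
        inhabited⇒nonZero : ∀ {n} → Fin n → NonZero n
        inhabited⇒nonZero zero    = _
        inhabited⇒nonZero (suc _) = _

        τ₀τ₂≡ : ∀ x → τ₀ (τ₂ x) ≡ τ₀τ₂ x
        τ₀τ₂≡ (d , h , b) = cong (λ b → reverse d , h , b) (not-involutive b)

        τ₂τ₀≡ : ∀ x → τ₂ (τ₀ x) ≡ τ₀τ₂ x
        τ₂τ₀≡ (d , h , b) = cong (λ b → reverse d , h , b) (not-involutive b)

      -- Vertices and faces are both numbered by `V`, and edges by `D` as each edge is doubled.
      -- Hence χ = 2v - d, and the hypothesis is χ = 2 - 2h without subtraction.
      tubeMap-decomposes : ∀ h → v + v + 2 * h ≡ 2 + d → tubeMap Decomposes (sphereWithHandles h)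
      tubeMap-decomposes h eq =
        (side ∘ F.from , λ i → side-conj τ₀ (λ _ → refl) i
                             , side-conj τ₁ side-τ₁ i
                             , side-conj τ₂ (λ _ → refl) i)
        , χ
        where
        side-conj : ∀ τ → (∀ x → side (τ x) ≡ not (side x)) →
          ∀ i → side (F.from (conjugate Flag↔ τ i)) ≡ not (side (F.from i))
        side-conj τ side-τ i = trans (cong side (F.strictlyInverseʳ _)) (side-τ _)

        rearrange : ∀ a b c → a ℤ.- b ℤ.+ a ≡ (a ℤ.+ a ℤ.+ c) ℤ.- b ℤ.- c
        rearrange = solve-∀ℤ

        cancel : ∀ b c → (+ 2 ℤ.+ b) ℤ.- b ℤ.- c ≡ + 2 ℤ.- c
        cancel = solve-∀ℤ

        χ : + v ℤ.- + d ℤ.+ + v ≡ + 2 ℤ.- + (2 * h)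
        χ = trans (rearrange (+ v) (+ d) (+ (2 * h)))
          (trans (cong (λ z → z ℤ.- + d ℤ.- + (2 * h)) (cong +_ eq)) (cancel (+ d) (+ (2 * h))))

      link-drawn : ∀ {x y} → Link x y →
        ∃[ f ] (CellDecomposition.vertexOf tubeMap f ≡ Inverse.to V↔ x
              × CellDecomposition.vertexOf tubeMap (CellDecomposition.τ₀ tubeMap f) ≡ Inverse.to V↔ y)
      link-drawn (d , refl , refl) = F.to (base d)
        , cong vertex (F.strictlyInverseʳ (base d))
        , trans (cong vertex (F.strictlyInverseʳ _)) (cong (vertex ∘ τ₀) (F.strictlyInverseʳ (base d)))
        where
        vertex : Flag → Fin v
        vertex = Inverse.to V↔ ∘ origin

-- Cycles as periodic walks

-- Indexing by ℕ allows the walk to be entered at any point, so that no cycle has to be rotated.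
-- Distinctness of the vertices is passed on as `no-back`.
record PeriodicWalk {A : Set} (R : Rel A 0ℓ) (period : ℕ) : Set where
  field
    at       : ℕ → A
    step     : ∀ n → R (at n) (at (suc n))
    no-back  : ∀ n → at n ≢ at (2 + n)
    periodic : ∀ n → at (period + n) ≡ at n

module _ {A : Set} (start : A) (rest : List A) where

  -- `xs` is the unread part of the current lap; the walk itself is the case `[]`, and arbitrary
  -- `xs` make the inductions possible.
  cyclingFrom : List A → ℕ → A
  cyclingFrom []       zero    = start
  cyclingFrom []       (suc n) = cyclingFrom rest n
  cyclingFrom (x ∷ xs) zero    = x
  cyclingFrom (x ∷ xs) (suc n) = cyclingFrom xs n

  cycling-periodic : ∀ xs n → cyclingFrom xs (length xs + n) ≡ cyclingFrom [] n
  cycling-periodic []       n = refl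
  cycling-periodic (x ∷ xs) n = cycling-periodic xs n

  module _ {R : Rel A 0ℓ} (closed : Linked R (start ∷ rest ∷ʳ start)) where

    step-into : ∀ {x} xs → Linked R (x ∷ xs ∷ʳ start) → R x (cyclingFrom xs zero)
    step-into []       (r ∷ _) = r
    step-into (x ∷ xs) (r ∷ _) = r

    cycling-step : ∀ xs n → Linked R (xs ∷ʳ start) →
      R (cyclingFrom xs n) (cyclingFrom xs (suc n))
    cycling-step []       zero    _ = step-into rest closed
    cycling-step []       (suc n) _ = cycling-step rest n (Linked.tail closed)
    cycling-step (x ∷ xs) zero    l = step-into xs l
    cycling-step (x ∷ [])     (suc n) (_ ∷ l) = cycling-step [] n l
    cycling-step (x ∷ y ∷ xs) (suc n) (_ ∷ l) = cycling-step (y ∷ xs) n l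

-- Looking two steps ahead over the end of a lap meets `s` or `r` again, so `go` keeps track that
-- the unread part `xs` avoids both.
cycling-no-back : ∀ {A : Set} {s r r′ : A} {rs} → Unique (s ∷ r ∷ r′ ∷ rs) →
  ∀ n → cyclingFrom s (r ∷ r′ ∷ rs) [] n ≢ cyclingFrom s (r ∷ r′ ∷ rs) [] (2 + n)
cycling-no-back {s = s} {r} {r′} {rs} (s≢@(s≢r ∷ s≢r′ ∷ _) ∷ r≢@(r≢r′ ∷ _) ∷ unique) =
  λ n → go [] n [] [] []
  where
  at = cyclingFrom s (r ∷ r′ ∷ rs)

  r≢third : ∀ qs → All (r ≢_) (r′ ∷ qs) → r ≢ at qs zero
  r≢third []      _              r≡s = s≢r (sym r≡s)
  r≢third (_ ∷ _) (_ ∷ r≢r″ ∷ _) = r≢r″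

  go : ∀ xs n → All (s ≢_) xs → All (r ≢_) xs → Unique xs → at xs n ≢ at xs (2 + n)
  go []               zero          _ _ _ = s≢r′
  go []               (suc zero)    _ _ _ = r≢third rs r≢
  go []               (suc (suc n)) _ _ _ = go (r′ ∷ rs) n (All.tail s≢) r≢ unique
  go (a ∷ [])         zero          _ (r≢a ∷ _) _ a≡r = r≢a (sym a≡r)
  go (a ∷ b ∷ [])     zero          (s≢a ∷ _) _ _ a≡s = s≢a (sym a≡s)
  go (a ∷ b ∷ c ∷ _)  zero          _ _ ((_ ∷ a≢c ∷ _) ∷ _) = a≢c
  go (a ∷ xs)         (suc n)       (_ ∷ s≢) (_ ∷ r≢) (_ ∷ u) = go xs n s≢ r≢ u

module _ (G : Graph) where
  open Graph G

  cycle⇒walk : (C : Cycle G) → PeriodicWalk Adj (Cycle.cycleLength C)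
  cycle⇒walk record { start = s ; rest = rs@(_ ∷ _ ∷ _) ; closed = closed ; distinct = distinct } =
    record
      { at       = cyclingFrom s rs []
      ; step     = λ n → cycling-step s rs closed [] n [-]
      ; no-back  = cycling-no-back distinct
      ; periodic = cycling-periodic s rs rs
      }
  cycle⇒walk record { rest = [] ; long = s≤s () }
  cycle⇒walk record { rest = _ ∷ [] ; long = s≤s (s≤s ()) }

  -- Counting neighbors of the same color

  module _ {k : ℕ} (d : Vec ℕ k) (coloring : Colorable G d) where

    private
      color : Vertex → Fin k
      color = proj₁ coloring

    -- The index of `w` in the list of same-colored neighbors of `v` fits below the bound for the
    -- color. Naming the color `c` puts the slots of different vertices into one type, and bounds on
    -- degrees become injections.
    slot : ∀ {v w c} → Adj v w → color v ≡ c → color w ≡ c → Fin (lookup d c)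
    slot {v} {w} adj refl same = Fin.inject≤ (index w∈) (proj₂ coloring v)
      where
      w∈ : w ∈ sameColorNeighbors G color v
      w∈ = ∈-filter⁺ _ (∈-allFin w) (adj , same)

    slot-injective : ∀ {v w w′ c} (a : Adj v w) (e : color v ≡ c) s (a′ : Adj v w′) e′ s′ →
      slot a e s ≡ slot a′ e′ s′ → w ≡ w′
    slot-injective a refl s a′ refl s′ eq =
      index-injective (setoid _) _ _ (Fin.inject≤-injective _ _ _ _ eq)

-- Finite types

from-injective : (e : A ↔ Fin a) → Injective _≡_ _≡_ (Inverse.from e)
from-injective e eq = trans (sym (strictlyInverseˡ _)) (trans (cong to eq) (strictlyInverseˡ _))
  where open Inverse e

to-injective : (e : A ↔ Fin a) → Injective _≡_ _≡_ (Inverse.to e)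
to-injective e eq = trans (sym (strictlyInverseʳ _)) (trans (cong from eq) (strictlyInverseʳ _))
  where open Inverse e

injection⇒≤ : A ↔ Fin a → B ↔ Fin b → {f : A → B} → Injective _≡_ _≡_ f → a ≤ b
injection⇒≤ eA eB f-inj =
  Fin.injective⇒≤ (λ eq → from-injective eA (f-inj (to-injective eB eq)))

infixr 2 _×-Fin_
infixr 1 _⊎-Fin_

_×-Fin_ : A ↔ Fin a → B ↔ Fin b → (A × B) ↔ Fin (a * b)
eA ×-Fin eB = ↔-trans (eA ×-↔ eB) (↔-sym *↔×)

_⊎-Fin_ : A ↔ Fin a → B ↔ Fin b → (A ⊎ B) ↔ Fin (a + b)
eA ⊎-Fin eB = ↔-trans (eA ⊎-↔ eB) (↔-sym +↔⊎)

Bool↔ : Bool ↔ Fin 2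
Bool↔ = ↔-sym 2↔Bool

-- The graph

pattern hub s x   = inj₁ (s , x)
pattern mid s x y = inj₂ (s , x , y)

module Construction (m : ℕ) where

  Position : Set
  Position = Fin m × Bool

  -- hub s (i , t) is the twin t of the i-th pair on the side s, and mid s x y is
  -- the neighbor of hub s x on the path to hub (not s) y.
  V : Set
  V = (Bool × Position) ⊎ (Bool × Position × Position)

  twin : Position → Position
  twin (i , t) = i , not t

  twin-invol : ∀ x → twin (twin x) ≡ x
  twin-invol (i , t) = cong (i ,_) (not-involutive t)

  _≟ₚ_ : DecidableEquality (Position)
  _≟ₚ_ = ≡-dec Fin._≟_ Bool._≟_

  _—_ : Rel (V) 0ℓ
  hub s x   — hub s′ x′    = s′ ≡ s × x′ ≡ twin x
  hub s x   — mid s′ x′ y′ = s′ ≡ s × x′ ≡ x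
  mid s x y — hub s′ x′    = s′ ≡ s × x′ ≡ x
  mid s x y — mid s′ x′ y′ = s′ ≡ not s × x′ ≡ y × y′ ≡ x

  _—?_ : Decidable _—_
  hub s x   —? hub s′ x′    = (s′ Bool.≟ s) ×-dec (x′ ≟ₚ twin x)
  hub s x   —? mid s′ x′ y′ = (s′ Bool.≟ s) ×-dec (x′ ≟ₚ x)
  mid s x y —? hub s′ x′    = (s′ Bool.≟ s) ×-dec (x′ ≟ₚ x)
  mid s x y —? mid s′ x′ y′ = (s′ Bool.≟ not s) ×-dec ((x′ ≟ₚ y) ×-dec (y′ ≟ₚ x))

  —-sym : Symmetric _—_
  —-sym {hub s x}   {hub _ _}   (refl , refl) = refl , sym (twin-invol x)
  —-sym {hub _ _}   {mid _ _ _} (refl , refl) = refl , refl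
  —-sym {mid _ _ _} {hub _ _}   (refl , refl) = refl , refl
  —-sym {mid s _ _} {mid _ _ _} (refl , refl , refl) = sym (not-involutive s) , refl , refl

  —-irrefl : ∀ v → ¬ v — v
  —-irrefl (hub s (i , t)) (_ , eq) = not-¬ refl (cong proj₂ eq)
  —-irrefl (mid s x y)     (eq , _) = not-¬ refl eq

  -- The girth of the graph

  hub-hub-hub : ∀ s x {s₁ x₁ s₂ x₂} → hub s x — hub s₁ x₁ → hub s₁ x₁ — hub s₂ x₂ →
    _≡_ {A = V} (hub s x) (hub s₂ x₂)
  hub-hub-hub s x (refl , refl) (refl , refl) = cong (hub s) (sym (twin-invol x))

  mid-mid-mid : ∀ s x y {s₁ x₁ y₁ s₂ x₂ y₂} → mid s x y — mid s₁ x₁ y₁ →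
    mid s₁ x₁ y₁ — mid s₂ x₂ y₂ →
    _≡_ {A = V} (mid s x y) (mid s₂ x₂ y₂)
  mid-mid-mid s x y (refl , refl , refl) (refl , refl , refl) =
    cong (λ s → mid s x y) (sym (not-involutive s))

  data Spoke : Rel V 0ℓ where
    spoke : ∀ s x y → Spoke (hub s x) (mid s x y)

  -- A hub has one hub neighbor and a `mid` one `mid` neighbor, so a walk that never turns back has
  -- at most two of a kind in a row. The latest spoke occurs in mid, mid, hub, hub, mid.
  some-spoke : ∀ {a b c d e} → a — b → b — c → c — d → d — e → a ≢ c → b ≢ d → c ≢ e →
    Spoke a b ⊎ Spoke b c ⊎ Spoke c d ⊎ Spoke d e
  some-spoke {hub _ _} {mid _ _ _} (refl , refl) _ _ _ _ _ _ = inj₁ (spoke _ _ _)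
  some-spoke {hub s x} {hub _ _} {hub _ _} ab bc _ _ a≢c _ _ =
    contradiction (hub-hub-hub s x ab bc) a≢c
  some-spoke {_} {hub _ _} {mid _ _ _} _ (refl , refl) _ _ _ _ _ = inj₂ (inj₁ (spoke _ _ _))
  some-spoke {mid _ _ _} {hub s x} {hub _ _} {hub _ _} _ bc cd _ _ b≢d _ =
    contradiction (hub-hub-hub s x bc cd) b≢d
  some-spoke {_} {_} {hub _ _} {mid _ _ _} _ _ (refl , refl) _ _ _ _ =
    inj₂ (inj₂ (inj₁ (spoke _ _ _)))
  some-spoke {mid s x y} {mid _ _ _} {mid _ _ _} ab bc _ _ a≢c _ _ =
    contradiction (mid-mid-mid s x y ab bc) a≢c
  some-spoke {mid _ _ _} {mid _ _ _} {hub s x} {hub _ _} {hub _ _} _ _ cd de _ _ c≢e =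
    contradiction (hub-hub-hub s x cd de) c≢e
  some-spoke {mid _ _ _} {mid _ _ _} {hub _ _} {hub _ _} {mid _ _ _} _ _ _ (refl , refl) _ _ _ =
    inj₂ (inj₂ (inj₂ (spoke _ _ _)))

  hub-injective : ∀ {s s′ x x′} → _≡_ {A = V} (hub s x) (hub s′ x′) → s ≡ s′ × x ≡ x′
  hub-injective refl = refl , refl

  opposite-hubs : ∀ {s x x′} → _≢_ {A = V} (hub s x) (hub (not s) x′)
  opposite-hubs eq = not-¬ refl (proj₁ (hub-injective eq))

  -- After a spoke, a walk that never turns back runs through one long edge
  -- hub—mid—mid—hub to the other side, and returns to the first side only by
  -- a second one.
  spoke-no-return : ∀ {v₀ v₁ v₂ v₃ v₄ v₅ v₆} → Spoke v₀ v₁ →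
    v₁ — v₂ → v₂ — v₃ → v₃ — v₄ → v₄ — v₅ → v₅ — v₆ →
    v₀ ≢ v₂ → v₁ ≢ v₃ → v₂ ≢ v₄ → v₃ ≢ v₅ → v₄ ≢ v₆ →
    v₀ ≢ v₃ × v₀ ≢ v₄ × v₀ ≢ v₅ × v₀ ≢ v₆
  spoke-no-return {v₂ = hub _ _} (spoke s x y) (refl , refl) _ _ _ _ v₀≢v₂ _ _ _ _ =
    contradiction refl v₀≢v₂
  spoke-no-return {v₂ = mid _ _ _} {mid _ _ _} (spoke s x y) v₁—v₂ v₂—v₃ _ _ _ _ v₁≢v₃ _ _ _ =
    contradiction (mid-mid-mid s x y v₁—v₂ v₂—v₃) v₁≢v₃
  spoke-no-return {v₂ = mid _ _ _} {hub _ _} {hub _ _} {hub _ _} (spoke s x y)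
    (refl , refl , refl) (refl , refl) v₃—v₄ v₄—v₅ _ _ _ _ v₃≢v₅ _ =
    contradiction (hub-hub-hub (not s) y v₃—v₄ v₄—v₅) v₃≢v₅
  spoke-no-return {v₂ = mid _ _ _} {hub _ _} {hub _ _} {mid _ _ _} {hub _ _} (spoke s x y)
    (refl , refl , refl) (refl , refl) (refl , refl) (refl , refl) (refl , refl) _ _ _ _ v₄≢v₆ =
    contradiction refl v₄≢v₆
  spoke-no-return {v₂ = mid _ _ _} {hub _ _} {hub _ _} {mid _ _ _} {mid _ _ _} (spoke s x y)
    (refl , refl , refl) (refl , refl) (refl , refl) _ _ _ _ _ _ _ =
    opposite-hubs , opposite-hubs , (λ ()) , (λ ())
  spoke-no-return {v₂ = mid _ _ _} {hub _ _} {mid _ _ _} {hub _ _} (spoke s x y)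
    (refl , refl , refl) (refl , refl) (refl , refl) (refl , refl) _ _ _ _ v₃≢v₅ _ =
    contradiction refl v₃≢v₅
  spoke-no-return {v₂ = mid _ _ _} {hub _ _} {mid _ _ _} {mid _ _ _} {mid _ _ _} (spoke s x y)
    (refl , refl , refl) (refl , refl) _ _ _ _ _ _ _ _ =
    opposite-hubs , (λ ()) , (λ ()) , (λ ())
  -- Two long edges in succession, through the same hub `v₃`: if also `v₀ ≡ v₆`, they have the same
  -- ends, so they coincide and `v₂ ≡ v₄`.
  spoke-no-return {v₂ = mid _ _ _} {hub _ _} {mid _ _ _} {mid _ _ _} {hub _ _} (spoke s x y)
    (refl , refl , refl) (refl , refl) (refl , refl) (refl , refl , refl) (refl , refl) _ _ v₂≢v₄ _ _ =
    opposite-hubs , (λ ()) , (λ ()) ,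
    (λ eq → v₂≢v₄ (cong (mid′ (not s) y) (proj₂ (hub-injective eq))))
    where
    mid′ : Bool → Position → Position → V
    mid′ s x y = mid s x y

  -- Read from a spoke on, the walk is away from its start after 3, 4, 5 and 6 steps, so none of
  -- these is a period.
  walk-period : ∀ {L} → 3 ≤ L → PeriodicWalk _—_ L → 7 ≤ L
  walk-period {L} 3≤L W = 7≤L some
    where
    open PeriodicWalk W

    some : ∃[ j ] Spoke (at j) (at (suc j))
    some with some-spoke (step 0) (step 1) (step 2) (step 3) (no-back 0) (no-back 1) (no-back 2)
    ... | inj₁ p               = 0 , p
    ... | inj₂ (inj₁ p)        = 1 , p
    ... | inj₂ (inj₂ (inj₁ p)) = 2 , p
    ... | inj₂ (inj₂ (inj₂ p)) = 3 , p

    7≤L : ∃[ j ] Spoke (at j) (at (suc j)) → 7 ≤ L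
    7≤L (j , p) with spoke-no-return p (step _) (step _) (step _) (step _) (step _)
                       (no-back _) (no-back _) (no-back _) (no-back _) (no-back _)
    ... | ≢₃ , ≢₄ , ≢₅ , ≢₆ =
      ℕ.≤∧≢⇒< (ℕ.≤∧≢⇒< (ℕ.≤∧≢⇒< (ℕ.≤∧≢⇒< 3≤L (avoid ≢₃)) (avoid ≢₄)) (avoid ≢₅)) (avoid ≢₆)
      where
      avoid : ∀ {i} → at j ≢ at (i + j) → i ≢ L
      avoid at≢ refl = at≢ (sym (periodic j))

  Position↔ : Position ↔ Fin (m * 2)
  Position↔ = ↔-refl ×-Fin Bool↔

  order : ℕ
  order = 2 * (m * 2) + 2 * (m * 2 * (m * 2))

  V↔ : V ↔ Fin order
  V↔ = Bool↔ ×-Fin Position↔ ⊎-Fin Bool↔ ×-Fin Position↔ ×-Fin Position↔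

  open Inverse V↔

  graph : Graph
  graph = record
    { order  = order
    ; Adj    = λ u v → from u — from v
    ; adj?   = λ u v → from u —? from v
    ; sym    = λ {u} {v} → —-sym {from u} {from v}
    ; irrefl = λ { {u} refl → —-irrefl (from u) }
    }

  girth≥7 : GirthAtLeast graph 7
  girth≥7 C = walk-period (Cycle.long C) record
    { at       = from ∘ at
    ; step     = step
    ; no-back  = λ n eq → no-back n (from-injective V↔ eq)
    ; periodic = λ n → cong from (periodic n)
    }
    where open PeriodicWalk (cycle⇒walk graph C)

  -- Colorings of the graph

  module _ {k : ℕ} (coloring : Colorable graph (0 ∷ k ∷ [])) where

    color : V → Fin 2
    color = proj₁ coloring ∘ to

    adj-to : ∀ {u v} → u — v → from (to u) — from (to v)
    adj-to = subst₂ _—_ (sym (strictlyInverseʳ _)) (sym (strictlyInverseʳ _))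

    -- Two adjacent vertices of the first color would give a slot in `Fin 0`.
    one-of : ∀ u v → u — v → color u ≡ suc zero ⊎ color v ≡ suc zero
    one-of u v u—v with color u in eu | color v in ev
    ... | suc zero | _        = inj₁ refl
    ... | zero     | suc zero = inj₂ refl
    ... | zero     | zero     = contradiction
      (slot graph (0 ∷ k ∷ []) coloring (adj-to {u} {v} u—v) eu ev) λ ()

    chosen : ∀ s i → ∃[ t ] color (hub s (i , t)) ≡ suc zero
    chosen s i with one-of (hub s (i , false)) (hub s (i , true)) (refl , refl)
    ... | inj₁ e = false , e
    ... | inj₂ e = true , e

    place : Bool → Fin m → Position
    place s i = i , proj₁ (chosen s i)

    spoke-to : ∀ s x y → from (to (hub s x)) — from (to (mid s x y))
    spoke-to s x y = adj-to {hub s x} {mid s x y} (refl , refl)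

    hubSlot : ∀ s i y → color (mid s (place s i) y) ≡ suc zero → Fin k
    hubSlot s i y =
      slot graph (0 ∷ k ∷ []) coloring (spoke-to s (place s i) y) (proj₂ (chosen s i))

    hubSlot-injective : ∀ s i y e y′ e′ → hubSlot s i y e ≡ hubSlot s i y′ e′ → y ≡ y′
    hubSlot-injective s i y e y′ e′ eq = mid-end {s} {place s i} (to-injective V↔
      (slot-injective graph (0 ∷ k ∷ []) coloring
        (spoke-to s (place s i) y) (proj₂ (chosen s i)) e
        (spoke-to s (place s i) y′) (proj₂ (chosen s i)) e′ eq))
      where
      mid-end : ∀ {s x y y′} → _≡_ {A = V} (mid s x y) (mid s x y′) → y ≡ y′
      mid-end refl = refl

    -- Records which inner vertex of the path between the chosen hubs of pair `i` on one side and
    -- pair `j` on the other has the second color; the path is charged to the hub next to that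
    -- vertex.
    Charge : Fin m × Fin m → Set
    Charge (i , j) = color (mid false (place false i) (place true j)) ≡ suc zero
                   ⊎ color (mid true (place true j) (place false i)) ≡ suc zero

    charge : ∀ ij → Charge ij
    charge (i , j) = one-of (mid false (place false i) (place true j))
                            (mid true (place true j) (place false i)) (refl , refl , refl)

    charged : ∀ ij → Charge ij → Fin m × Fin k ⊎ Fin m × Fin k
    charged (i , j) (inj₁ e) = inj₁ (i , hubSlot false i (place true j) e)
    charged (i , j) (inj₂ e) = inj₂ (j , hubSlot true j (place false i) e)

    -- The charged hub fixes one end of the path, and its slot fixes the inner vertex, which in turn
    -- names the other end.
    charged-injective : ∀ ij ij′ c c′ → charged ij c ≡ charged ij′ c′ → ij ≡ ij′
    charged-injective (i , j) (i′ , j′) (inj₁ e) (inj₁ e′) eq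
      with refl ← ,-injectiveˡ (inj₁-injective eq) = cong (λ y → i , proj₁ y)
        (hubSlot-injective false i (place true j) e (place true j′) e′
          (,-injectiveʳ (inj₁-injective eq)))
    charged-injective (i , j) (i′ , j′) (inj₂ e) (inj₂ e′) eq
      with refl ← ,-injectiveˡ (inj₂-injective eq) = cong (λ x → proj₁ x , j)
        (hubSlot-injective true j (place false i) e (place false i′) e′
          (,-injectiveʳ (inj₂-injective eq)))

    colorable⇒≤ : m * m ≤ m * k + m * k
    colorable⇒≤ = injection⇒≤
      (↔-refl ×-Fin ↔-refl) (↔-refl ×-Fin ↔-refl ⊎-Fin ↔-refl ×-Fin ↔-refl)
      {λ ij → charged ij (charge ij)}
      (λ {ij} {ij′} → charged-injective ij ij′ (charge ij) (charge ij′))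

  -- The embedding of the graph

  -- At a hub, inj₁ tt is the dart to the twin and inj₂ y the one to mid s x y; at
  -- mid s x y, false is the dart to hub s x and true the one to mid (not s) y x.
  D : Set
  D = (Bool × Position × (⊤ ⊎ Position)) ⊎ (Bool × Position × Position × Bool)

  darts : ℕ
  darts = 2 * (m * 2 * (1 + m * 2)) + 2 * (m * 2 * (m * 2 * 2))

  D↔ : D ↔ Fin darts
  D↔ = Bool↔ ×-Fin Position↔ ×-Fin (↔-sym 1↔⊤ ⊎-Fin Position↔)
    ⊎-Fin Bool↔ ×-Fin Position↔ ×-Fin Position↔ ×-Fin Bool↔

  -- Any cyclic orders would do, since the doubled edges give one face per vertex in every case;
  -- those taken come from the enumerations.
  rotation : RotationSystem V D
  rotation = record
    { source        = source
    ; reverse       = reverse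
    ; positive      = positive
    ; next          = next
    ; prev          = prev
    ; dartAt        = dartAt
    ; reverse-invol = reverse-invol
    ; positive-rev  = positive-rev
    ; next-prev     = λ { (inj₁ _) → cong (λ r → inj₁ (_ , _ , r)) (H.next-prev _)
                        ; (inj₂ _) → cong (λ r → inj₂ (_ , _ , _ , r)) (M.next-prev _) }
    ; prev-next     = λ { (inj₁ _) → cong (λ r → inj₁ (_ , _ , r)) (H.prev-next _)
                        ; (inj₂ _) → cong (λ r → inj₂ (_ , _ , _ , r)) (M.prev-next _) }
    ; source-next   = λ { (inj₁ _) → refl ; (inj₂ _) → refl }
    ; source-dartAt = λ { (hub _ _) → refl ; (mid _ _ _) → refl }
    ; next-orbit    = next-orbit
    }
    where
    module H = CyclicOrder (cyclicOrder (↔-sym 1↔⊤ ⊎-Fin Position↔))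
    module M = CyclicOrder (cyclicOrder Bool↔)

    source : D → V
    source (inj₁ (s , x , _))     = hub s x
    source (inj₂ (s , x , y , _)) = mid s x y

    reverse : D → D
    reverse (inj₁ (s , x , inj₁ tt))    = inj₁ (s , twin x , inj₁ tt)
    reverse (inj₁ (s , x , inj₂ y))     = inj₂ (s , x , y , false)
    reverse (inj₂ (s , x , y , false))  = inj₁ (s , x , inj₂ y)
    reverse (inj₂ (s , x , y , true))   = inj₂ (not s , y , x , true)

    positive : D → Bool
    positive (inj₁ (s , (i , t) , inj₁ tt)) = t
    positive (inj₁ (s , x , inj₂ y))        = true
    positive (inj₂ (s , x , y , false))     = false
    positive (inj₂ (s , x , y , true))      = s

    next prev : D → D
    next (inj₁ (s , x , r))     = inj₁ (s , x , H.next r)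
    next (inj₂ (s , x , y , r)) = inj₂ (s , x , y , M.next r)
    prev (inj₁ (s , x , r))     = inj₁ (s , x , H.prev r)
    prev (inj₂ (s , x , y , r)) = inj₂ (s , x , y , M.prev r)

    dartAt : V → D
    dartAt (hub s x)   = inj₁ (s , x , inj₁ tt)
    dartAt (mid s x y) = inj₂ (s , x , y , false)

    reverse-invol : ∀ d → reverse (reverse d) ≡ d
    reverse-invol (inj₁ (s , x , inj₁ tt))   = cong (λ x → inj₁ (s , x , inj₁ tt)) (twin-invol x)
    reverse-invol (inj₁ (s , x , inj₂ y))    = refl
    reverse-invol (inj₂ (s , x , y , false)) = refl
    reverse-invol (inj₂ (s , x , y , true))  = cong (λ s → inj₂ (s , x , y , true)) (not-involutive s)

    positive-rev : ∀ d → positive (reverse d) ≡ not (positive d)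
    positive-rev (inj₁ (s , x , inj₁ tt))   = refl
    positive-rev (inj₁ (s , x , inj₂ y))    = refl
    positive-rev (inj₂ (s , x , y , false)) = refl
    positive-rev (inj₂ (s , x , y , true))  = refl

    next-orbit : ∀ d → EqClosure (Step next) (dartAt (source d)) d
    next-orbit (inj₁ (s , x , r))     =
      EqC.gmap (λ r → inj₁ (s , x , r)) (cong (λ r → inj₁ (s , x , r))) (H.transitive _ r)
    next-orbit (inj₂ (s , x , y , r)) =
      EqC.gmap (λ r → inj₂ (s , x , y , r)) (cong (λ r → inj₂ (s , x , y , r))) (M.transitive _ r)

  open RotationSystem rotation using (Link)

  adj⇒link : ∀ u v → u — v → Link u v
  adj⇒link (hub s x)   (hub _ _)   (refl , refl)        = inj₁ (s , x , inj₁ tt) , refl , refl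
  adj⇒link (hub s x)   (mid _ _ y) (refl , refl)        = inj₁ (s , x , inj₂ y) , refl , refl
  adj⇒link (mid s x y) (hub _ _)   (refl , refl)        = inj₂ (s , x , y , false) , refl , refl
  adj⇒link (mid s x y) (mid _ _ _) (refl , refl , refl) = inj₂ (s , x , y , true) , refl , refl

  module _ (root : Position) where

    adj-path : ∀ u v → u — v → EqClosure Link u v
    adj-path u v u—v = EqC.return (adj⇒link u v u—v)

    across : ∀ s x y → EqClosure Link (hub s x) (hub (not s) y)
    across s x y =
      adj-path (hub s x) (mid s x y) (refl , refl) ◅◅
      adj-path (mid s x y) (mid (not s) y x) (refl , refl , refl) ◅◅
      adj-path (mid (not s) y x) (hub (not s) y) (refl , refl)

    -- A hub on the side of the root crosses over and comes back, since only hubs on different sides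
    -- are joined by long edges.
    to-root : ∀ v → EqClosure Link v (hub false root)
    to-root (hub true x)    = across true x root
    to-root (hub false x)   = across false x root ◅◅ across true root root
    to-root (mid true x y)  = adj-path (mid true x y) (hub true x) (refl , refl) ◅◅ across true x root
    to-root (mid false x y) =
      adj-path (mid false x y) (hub false x) (refl , refl) ◅◅
      across false x root ◅◅ across true root root

    connected : ∀ u v → EqClosure Link u v
    connected u v = to-root u ◅◅ EqC.symmetric _ (to-root v)

    open TubeMap rotation

    Flag↔ : Flag ↔ Fin (darts * (2 * 2))
    Flag↔ = D↔ ×-Fin Bool↔ ×-Fin Bool↔

    embeddable : ∀ h → order + order + 2 * h ≡ 2 + darts → graph EmbeddableOn sphereWithHandles h
    embeddable h eq =
        tubeMap connected V↔ D↔ Flag↔ dart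
      , tubeMap-decomposes connected V↔ D↔ Flag↔ dart h eq
      -- `V↔` numbers the vertices of the graph and of the map alike.
      , (λ u → u)
      , (λ eq → eq)
      , λ u v adj → subst₂ (λ a b → ∃[ f ] (vertexOf f ≡ a × vertexOf (CD.τ₀ f) ≡ b))
          (strictlyInverseˡ u) (strictlyInverseˡ v)
          (link-drawn connected V↔ D↔ Flag↔ dart (adj⇒link (from u) (from v) adj))
      where
      dart : D
      dart = inj₁ (false , root , inj₁ tt)
      module CD = CellDecomposition (tubeMap connected V↔ D↔ Flag↔ dart)
      open CD using (vertexOf)

-- Arithmetic

-- The floor of √n / 8, squared and with the denominator 64 cleared. It grows by at most one when
-- `n` does.
floor-sqrt/8 : ∀ n → ∃[ k ] (k * k * 64 ≤ n × n < suc k * suc k * 64)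
floor-sqrt/8 zero = 0 , z≤n , s≤s z≤n
floor-sqrt/8 (suc n) with floor-sqrt/8 n
... | k , k²≤n , n<k⁺² with suc n ℕ.<? suc k * suc k * 64
...   | yes n⁺<k⁺² = k , ℕ.m≤n⇒m≤1+n k²≤n , n⁺<k⁺²
...   | no  n⁺≮k⁺² = suc k , ℕ.≮⇒≥ n⁺≮k⁺² ,
  ℕ.≤-<-trans n<k⁺² (ℕ.*-monoˡ-< 64 (ℕ.*-mono-< (ℕ.n<1+n (suc k)) (ℕ.n<1+n (suc k))))

1/8ᵘ : ℚᵘ
-- The second argument is the denominator minus one.
1/8ᵘ = mkℚᵘ (+ 1) 7

isFloor : ∀ k g → k * k * 64 ≤ g → g < suc k * suc k * 64 → k IsFloorOf 1/8ᵘ √ g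
isFloor k g lower upper =
    -- Unnormalised fractions compare by cross multiplication, here with denominators 1 and 64.
    *≤* (subst₂ ℤ._≤_ (lhs k) rhs (ℤ.+≤+ lower))
  , *<* (subst₂ ℤ._<_ rhs (lhs (suc k)) (ℤ.+<+ upper))
  where
  lhs : ∀ k → + (k * k * 64) ≡ + k ℤ.* + k ℤ.* + 64
  lhs k = trans (ℤ.pos-* (k * k) 64) (cong (ℤ._* + 64) (ℤ.pos-* k k))
  rhs : + g ≡ + 1 ℤ.* + g ℤ.* + 1
  rhs = sym (trans (ℤ.*-identityʳ _) (ℤ.*-identityˡ _))

-- Here `q` = 2m is the number of positions on a side, so that the graph has 2q + 2q² vertices and
-- 2q + 6q² darts; solving for the number of handles gives 1 + (q - 1)q.
euler-count : ∀ r → let q = suc r in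
  (2 * q + 2 * (q * q)) + (2 * q + 2 * (q * q)) + 2 * (1 + r * q) ≡
  2 + (2 * (q * (1 + q)) + 2 * (q * (q * 2)))
euler-count = solve-∀

handles genus : ℕ → ℕ
handles N = 1 + (1 + N * 2) * (2 + N * 2)
genus N = 2 * handles N

-- This identity and the next two are inequalities with the slack written out: N < g, g < 8m² for m
-- = N + 1, and 8(2k)² ≤ 64k².
genus-large : ∀ N → suc N + (5 + 11 * N + 8 * (N * N)) ≡ 2 * (1 + (1 + N * 2) * (2 + N * 2))
genus-large = solve-∀

genus-small : ∀ N → suc (2 * (1 + (1 + N * 2) * (2 + N * 2))) + (1 + 4 * N) ≡ suc N * suc N * 8
genus-small = solve-∀

double-square : ∀ k → (k + k) * (k + k) * 8 + k * k * 32 ≡ k * k * 64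
double-square = solve-∀

-- Cancelling `m` in the count of charges leaves m ≤ 2k, against 64k² ≤ g < 8m².
not-colorable : ∀ N k → k * k * 64 ≤ genus N →
  ¬ Colorable (Construction.graph (suc N)) (0 ∷ k ∷ [])
not-colorable N k lower coloring = ℕ.<-irrefl refl (begin-strict
  k * k * 64              ≤⟨ lower ⟩
  genus N                 <⟨ ℕ.m+n≤o⇒m≤o _ (ℕ.≤-reflexive (genus-small N)) ⟩
  m * m * 8               ≤⟨ ℕ.*-monoˡ-≤ 8 (ℕ.*-mono-≤ m≤2k m≤2k) ⟩
  (k + k) * (k + k) * 8   ≤⟨ ℕ.m+n≤o⇒m≤o _ (ℕ.≤-reflexive (double-square k)) ⟩
  k * k * 64              ∎)
  where
  open ℕ.≤-Reasoning
  m = suc N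
  m≤2k : m ≤ k + k
  m≤2k = ℕ.*-cancelˡ-≤ m (ℕ.≤-trans (Construction.colorable⇒≤ m coloring)
    (ℕ.≤-reflexive (sym (ℕ.*-distribˡ-+ m k k))))

mainTheorem12 : Σ[ c ∈ ℚᵘ ] (0ℚᵘ ℚᵘ.< c ×
    (∀ (N : ℕ) → Σ[ g ∈ ℕ ] (N < g ×
    Σ[ G ∈ Graph ] (GirthAtLeast G 7
    × (Σ[ S ∈ Surface ] (eulerGenus S ≡ g × G EmbeddableOn S))
    × (Σ[ k ∈ ℕ ] (k IsFloorOf c √ g × ¬ Colorable G (0 ∷ k ∷ [])))))))
mainTheorem12 = 1/8ᵘ , *<* (ℤ.+<+ (s≤s z≤n)) , λ N →
  -- With m = N + 1 pairs on each side there is a hub to serve as root, and the Euler genus exceeds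
  -- `N`.
  let open Construction (suc N)
      k , lower , upper = floor-sqrt/8 (genus N)
  in genus N
   , ℕ.m+n≤o⇒m≤o _ (ℕ.≤-reflexive (genus-large N))
   , graph
   , girth≥7
   , (sphereWithHandles (handles N) , refl ,
        embeddable (zero , false) (handles N) (euler-count (1 + N * 2)))
   , k , isFloor k (genus N) lower upper , not-colorable N k lower
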